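{- Let $G$ be a broken sun graph of order $n$ which has a perfect matching and such that $2$ is an eigenvalue of the Laplacian matrix $L(G)$. Then there exist a real number $r\neq 0$ and an eigenvector $X=(x_1,\ldots,x_n)^t$ of $L(G)$ corresponding to the eigenvalue $2$ such that $x_i\in\{ -r,r\}$ for all $i=1,\ldots,n$.
   Context: All graphs are finite, undirected, with no loops or multiple edges. The Laplacian matrix of $G$ is $L(G)=D(G)-A(G)$, where $D(G)$ is the diagonal matrix of vertex degrees and $A(G)$ is the adjacency matrix. A unicyclic graph is a connected graph whose number of edges equals its number of vertices. The sun graph of order $2m$ ($m\ge 3$) is the cycle $C_m$ with one pendant vertex attached to each vertex of the cycle. A broken sun graph is a unicyclic subgraph of a sun graph (i.e. a cycle with at most one pendant vertex attached to each cycle vertex). -}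

module Defs where

open import Algebra.Apartness.Bundles using (HeytingField; HeytingCommutativeRing)
open import Algebra.Bundles using (CommutativeRing)
open import Data.Bool.Base using (if_then_else_)
open import Data.Empty using (⊥)
open import Data.Fin.Base using (Fin; toℕ)
import Data.Fin.Properties as Fin
open import Data.List.Base using (length; filter; allFin; cartesianProduct)
open import Data.Nat.Base as ℕ using (ℕ; suc; s≤s)
import Data.Nat.Properties as ℕ
open import Data.Product.Base using (Σ; ∃-syntax; _×_; _,_)
open import Data.Sum.Base using (_⊎_; inj₁; inj₂; swap)
open import Data.Vec.Functional using (Vector)
open import Function.Definitions using (Injective)
open import Level using (0ℓ; _⊔_) renaming (suc to lsuc)
open import Relation.Binary.Construct.Closure.ReflexiveTransitive using (Star)
open import Relation.Binary.Core using (Rel)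
open import Relation.Binary.Definitions using (Decidable; Symmetric; Irreflexive)
open import Relation.Binary.PropositionalEquality using (_≡_; refl; sym; trans; cong)
open import Relation.Binary.Structures using (IsStrictPartialOrder)
open import Relation.Nullary using (¬_; no; does)
open import Relation.Nullary.Decidable using (_×-dec_; _⊎-dec_)

import Algebra.Properties.Semiring.Mult as Mult
import Algebra.Properties.Semiring.Sum as Sum

------------------------------------------------------------------------
-- Graphs

record SimpleGraph (V : Set) : Set₁ where
  field
    Adj    : Rel V 0ℓ
    adj?   : Decidable Adj
    symm   : Symmetric Adj
    irrefl : Irreflexive _≡_ Adj

open SimpleGraph public

-- The null graph is not regarded as connected.
Connected : {V : Set} → SimpleGraph V → Set
Connected {V} G = V × (∀ u v → Star (Adj G) u v)

degree : ∀ {n} → SimpleGraph (Fin n) → Fin n → ℕ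
degree {n} G i = length (filter (adj? G i) (allFin n))

-- Each edge {i , j} is counted once, as the pair with i < j.
edgeCount : ∀ {n} → SimpleGraph (Fin n) → ℕ
edgeCount {n} G =
  length (filter (λ (i , j) → (i Fin.<? j) ×-dec adj? G i j)
                 (cartesianProduct (allFin n) (allFin n)))

Unicyclic : ∀ {n} → SimpleGraph (Fin n) → Set
Unicyclic {n} G = Connected G × edgeCount G ≡ n

-- Up to isomorphism; the subgraph need be neither induced nor spanning.
_IsSubgraphOf_ : {V W : Set} → SimpleGraph V → SimpleGraph W → Set
_IsSubgraphOf_ {V} {W} G H =
  Σ (V → W) λ f → Injective _≡_ _≡_ f × (∀ {u v} → Adj G u v → Adj H (f u) (f v))

-- A matching is given by its set of edges, a symmetric subrelation of
-- adjacency; it is perfect if each vertex lies on exactly one of them.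
record PerfectMatching {V : Set} (G : SimpleGraph V) : Set₁ where
  field
    Matched   : Rel V 0ℓ
    symmetric : Symmetric Matched
    isEdge    : ∀ {u v} → Matched u v → Adj G u v
    covers    : ∀ u → ∃[ v ] Matched u v
    unique    : ∀ {u v w} → Matched u v → Matched u w → v ≡ w

------------------------------------------------------------------------
-- Cycles and sun graphs

Next : ∀ {m} → Rel (Fin m) 0ℓ
Next {m} i j = toℕ j ≡ suc (toℕ i) ⊎ (suc (toℕ i) ≡ m × toℕ j ≡ 0)

next? : ∀ {m} → Decidable (Next {m})
next? {m} i j =
  (toℕ j ℕ.≟ suc (toℕ i)) ⊎-dec ((suc (toℕ i) ℕ.≟ m) ×-dec (toℕ j ℕ.≟ 0))

next-irrefl : ∀ {m} → 3 ℕ.≤ m → (i : Fin m) → ¬ Next i i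
next-irrefl 3≤m i (inj₁ eq) = ℕ.1+n≢n (sym eq)
next-irrefl 3≤m i (inj₂ (eq , i≡0))
  with s≤s () ← ℕ.≤-trans 3≤m (ℕ.≤-reflexive (trans (sym eq) (cong suc i≡0)))

cycleGraph : (m : ℕ) → 3 ℕ.≤ m → SimpleGraph (Fin m)
cycleGraph m 3≤m = record
  { Adj    = λ i j → Next i j ⊎ Next j i
  ; adj?   = λ i j → next? i j ⊎-dec next? j i
  ; symm   = swap
  ; irrefl = λ { {i} refl (inj₁ p) → next-irrefl 3≤m i p
               ; {i} refl (inj₂ p) → next-irrefl 3≤m i p }
  }

-- inj₁ i is the i-th cycle vertex and inj₂ i the pendant vertex attached to it.
SunAdj : (m : ℕ) → 3 ℕ.≤ m → Rel (Fin m ⊎ Fin m) 0ℓ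
SunAdj m 3≤m (inj₁ i) (inj₁ j) = Adj (cycleGraph m 3≤m) i j
SunAdj m 3≤m (inj₁ i) (inj₂ j) = i ≡ j
SunAdj m 3≤m (inj₂ i) (inj₁ j) = i ≡ j
SunAdj m 3≤m (inj₂ i) (inj₂ j) = ⊥

sunGraph : (m : ℕ) → 3 ℕ.≤ m → SimpleGraph (Fin m ⊎ Fin m)
sunGraph m 3≤m = record
  { Adj    = SunAdj m 3≤m
  ; adj?   = dec
  ; symm   = λ {u} {v} → sy u v
  ; irrefl = λ { {u} refl → irr u }
  }
  where
  dec : Decidable (SunAdj m 3≤m)
  dec (inj₁ i) (inj₁ j) = adj? (cycleGraph m 3≤m) i j
  dec (inj₁ i) (inj₂ j) = i Fin.≟ j
  dec (inj₂ i) (inj₁ j) = i Fin.≟ j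
  dec (inj₂ i) (inj₂ j) = no λ ()

  sy : ∀ u v → SunAdj m 3≤m u v → SunAdj m 3≤m v u
  sy (inj₁ i) (inj₁ j) p = symm (cycleGraph m 3≤m) {i} {j} p
  sy (inj₁ i) (inj₂ j) p = sym p
  sy (inj₂ i) (inj₁ j) p = sym p

  irr : ∀ u → ¬ SunAdj m 3≤m u u
  irr (inj₁ i) p = irrefl (cycleGraph m 3≤m) {i} refl p

BrokenSun : ∀ {n} → SimpleGraph (Fin n) → Set
BrokenSun G = Unicyclic G × (∃[ m ] Σ (3 ℕ.≤ m) λ 3≤m → G IsSubgraphOf sunGraph m 3≤m)

------------------------------------------------------------------------
-- The real numbers, axiomatically: a Cauchy-complete Archimedean ordered
-- field.  The axioms determine the field up to isomorphism.  They are stated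
-- with a strict order and an apartness, so that they hold of the constructive
-- (Bishop) reals; classically x # y is just ¬ x ≈ y.

record RealNumbers c ℓ₁ ℓ₂ ℓ₃ : Set (lsuc (c ⊔ ℓ₁ ⊔ ℓ₂ ⊔ ℓ₃)) where
  infix 4 _<_
  field
    heytingField : HeytingField c ℓ₁ ℓ₂

  open HeytingField heytingField public

  commutativeRing : CommutativeRing c ℓ₁
  commutativeRing = HeytingCommutativeRing.commutativeRing heytingCommutativeRing

  open CommutativeRing commutativeRing public using (semiring)
  open Mult semiring public using () renaming (_×_ to _·_)
  open Sum semiring public using (sum)

  field
    _<_                  : Rel Carrier ℓ₃
    isStrictPartialOrder : IsStrictPartialOrder _≈_ _<_
    <⇒#                  : ∀ {x y} → x < y → x # y
    #⇒<⊎>                : ∀ {x y} → x # y → x < y ⊎ y < x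
    +-monoˡ-<            : ∀ z {x y} → x < y → x + z < y + z
    *-pos                : ∀ {x y} → 0# < x → 0# < y → 0# < x * y
    archimedean          : ∀ x → ∃[ n ] x < n · 1#

  -- m and n play symmetric roles, so the one-sided bound gives |s m - s n| < ε.
  IsCauchy : (ℕ → Carrier) → Set (c ⊔ ℓ₃)
  IsCauchy s = ∀ ε → 0# < ε → ∃[ N ] (∀ m n → N ℕ.≤ m → N ℕ.≤ n → s m < s n + ε)

  _ConvergesTo_ : (ℕ → Carrier) → Carrier → Set (c ⊔ ℓ₃)
  s ConvergesTo l =
    ∀ ε → 0# < ε → ∃[ N ] (∀ n → N ℕ.≤ n → s n < l + ε × l < s n + ε)

  field
    complete : ∀ s → IsCauchy s → ∃[ l ] s ConvergesTo l

------------------------------------------------------------------------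
-- Matrices, eigenvalues and the Laplacian

module Spectral {c ℓ₁ ℓ₂ ℓ₃} (ℝ : RealNumbers c ℓ₁ ℓ₂ ℓ₃) where
  open RealNumbers ℝ

  Matrix : ℕ → Set c
  Matrix n = Fin n → Fin n → Carrier

  _*ᵥ_ : ∀ {n} → Matrix n → Vector Carrier n → Vector Carrier n
  (M *ᵥ X) i = sum λ j → M i j * X j

  IsEigenvector : ∀ {n} → Matrix n → Carrier → Vector Carrier n → Set ℓ₁
  IsEigenvector M μ X = ¬ (∀ i → X i ≈ 0#) × (∀ i → (M *ᵥ X) i ≈ μ * X i)

  IsEigenvalue : ∀ {n} → Matrix n → Carrier → Set (c ⊔ ℓ₁)
  IsEigenvalue M μ = ∃[ X ] IsEigenvector M μ X

  degreeMatrix : ∀ {n} → SimpleGraph (Fin n) → Matrix n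
  degreeMatrix G i j = if does (i Fin.≟ j) then degree G i · 1# else 0#

  adjacencyMatrix : ∀ {n} → SimpleGraph (Fin n) → Matrix n
  adjacencyMatrix G i j = if does (adj? G i j) then 1# else 0#

  laplacian : ∀ {n} → SimpleGraph (Fin n) → Matrix n
  laplacian G i j = degreeMatrix G i j - adjacencyMatrix G i j

  2# : Carrier
  2# = 2 · 1#

{-# OPTIONS --safe #-}
module Submission where

-- Give an edge the sign −1 if it lies in the perfect matching and +1 otherwise,
-- and call Σ_{u ~ v} (x_u − s_vu x_v) the net flow at v.  Since each vertex is on
-- exactly one matching edge, L X = 2 X says precisely that the net flow vanishes
-- everywhere.  If signs y_v can be chosen with y_u = s_vu y_v along each edge,
-- then every single flow of y is zero and y is the required eigenvector.  Walking
-- along the cycle produces such y unless all cycle edges are present and their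
-- signs multiply to −1.  In that case, let X be an eigenvector.  Pendant edges
-- carry no flow, so the flow along the cycle is multiplied by the edge sign
-- at each step; going round once, it equals its own negative, hence vanishes.
-- Then X itself is multiplied by the edge sign at each step and vanishes likewise.

open import Defs
import Algebra.Apartness.Properties.HeytingCommutativeRing as HeytingProperties
open import Algebra.Bundles using (CommutativeRing)
import Algebra.Properties.CommutativeSemigroup as CommutativeSemigroupProperties
import Algebra.Properties.Ring as RingProperties
import Algebra.Properties.Semiring.Sum as Sum
open import Data.Bool.Base using (true; false; if_then_else_)
open import Data.Fin.Base using (Fin; zero; suc; toℕ; fromℕ; inject₁; punchIn; punchOut)
open import Data.Fin.Induction using (<-weakInduction)
open import Data.Fin.Properties as Fin
  using (all?; any?; ¬∀⟶∃¬; toℕ-injective; toℕ-fromℕ; toℕ-inject₁; punchInᵢ≢i; punchIn-punchOut)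
open import Data.List.Base using (filter; length; tabulate)
open import Data.Nat.Base as ℕ using (ℕ; suc; s≤s)
import Data.Nat.Properties as ℕ
open import Data.Product.Base using (Σ; ∃-syntax; _×_; _,_; proj₁; proj₂)
open import Data.Sign.Base using (Sign; opposite) renaming (+ to plus; - to minus; _*_ to _⊗_)
import Data.Sign.Properties as Sign
open import Data.Sum.Base using (_⊎_; inj₁; inj₂; [_,_]′)
open import Data.Sum.Properties using (inj₁-injective; ≡-dec)
open import Data.Vec.Functional using (Vector; tail; foldr; updateAt; removeAt)
open import Data.Vec.Functional.Properties using (updateAt-minimal)
open import Function.Base using (_∘_)
open import Function.Definitions using (Injective)
open import Relation.Binary.PropositionalEquality as ≡ using (_≡_; _≢_; module ≡-Reasoning)
import Relation.Binary.Reasoning.Setoid as ≈-Reasoning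
open import Relation.Binary.Structures using (IsStrictPartialOrder)
open import Relation.Nullary using (¬_; Dec; yes; no; does; contradiction)
open import Relation.Nullary.Decidable using (_×-dec_; map′)
open import Relation.Unary using (Pred; Decidable)

open CommutativeSemigroupProperties Sign.*-commutativeSemigroup using (x∙yz≈y∙xz)

-- Signs multiplied along a cycle.

product : ∀ {m} → Vector Sign m → Sign
product = foldr _⊗_ plus

-- The sign reached at `i` by walking from vertex zero with value `plus`, where `σ k` belongs to the
-- edge from `k` to its successor; `σ i` itself is not yet included.
prefix : ∀ {m} → Vector Sign m → Fin m → Sign
prefix σ zero    = plus
prefix σ (suc i) = σ zero ⊗ prefix (tail σ) i

prefix-suc : ∀ {m} (σ : Vector Sign m) {i j} → toℕ j ≡ suc (toℕ i) → prefix σ j ≡ σ i ⊗ prefix σ i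
prefix-suc σ {zero}  {suc zero} _  = ≡.refl
prefix-suc σ {suc i} {suc j}    eq = begin
  σ zero ⊗ prefix (tail σ) j                   ≡⟨ ≡.cong (σ zero ⊗_) (prefix-suc (tail σ) (ℕ.suc-injective eq)) ⟩
  σ zero ⊗ (σ (suc i) ⊗ prefix (tail σ) i)     ≡⟨ x∙yz≈y∙xz (σ zero) (σ (suc i)) _ ⟩
  σ (suc i) ⊗ (σ zero ⊗ prefix (tail σ) i)     ∎
  where open ≡-Reasoning

-- Crossing the closing edge completes the product, so `product σ` is the sign with which the walk
-- comes back to its start.
prefix-last : ∀ {m} (σ : Vector Sign m) {i} → suc (toℕ i) ≡ m → product σ ≡ σ i ⊗ prefix σ i
prefix-last {suc ℕ.zero} σ {zero}  _  = ≡.refl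
prefix-last {suc m}      σ {suc i} eq = begin
  σ zero ⊗ product (tail σ)                    ≡⟨ ≡.cong (σ zero ⊗_) (prefix-last (tail σ) (ℕ.suc-injective eq)) ⟩
  σ zero ⊗ (σ (suc i) ⊗ prefix (tail σ) i)     ≡⟨ x∙yz≈y∙xz (σ zero) (σ (suc i)) _ ⟩
  σ (suc i) ⊗ (σ zero ⊗ prefix (tail σ) i)     ∎
  where open ≡-Reasoning

prefix-Next : ∀ {m} (σ : Vector Sign m) → product σ ≡ plus → ∀ {i j} → Next i j → prefix σ j ≡ σ i ⊗ prefix σ i
prefix-Next σ _    (inj₁ eq)                 = prefix-suc σ eq
-- The walk started with `plus` at vertex zero, so it closes up consistently because the total
-- product is `plus`.
prefix-Next σ σ≡+ {j = zero} (inj₂ (eq , _)) = ≡.trans (≡.sym σ≡+) (prefix-last σ eq)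

product-updateAt : ∀ {m} (σ : Vector Sign m) i → product (updateAt σ i opposite) ≡ opposite (product σ)
product-updateAt σ zero with σ zero
... | plus  = ≡.refl
... | minus = ≡.sym (Sign.opposite-involutive _)
product-updateAt σ (suc i) = begin
  σ zero ⊗ product (updateAt (tail σ) i opposite)     ≡⟨ ≡.cong (σ zero ⊗_) (product-updateAt (tail σ) i) ⟩
  σ zero ⊗ (minus ⊗ product (tail σ))                 ≡⟨ x∙yz≈y∙xz (σ zero) minus _ ⟩
  minus ⊗ (σ zero ⊗ product (tail σ))                 ∎
  where open ≡-Reasoning

-- If some edge fails P, its sign is free and can be flipped to make the product +1.
potential : ∀ {m} (σ : Vector Sign m) {ℓ} {P : Pred (Fin m) ℓ} → Decidable P →
            (∃[ y ] (∀ {i j} → P i → Next i j → y j ≡ σ i ⊗ y i)) ⊎ ((∀ i → P i) × product σ ≡ minus)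
potential σ P? with product σ in eq
... | plus = inj₁ (prefix σ , λ _ → prefix-Next σ eq)
... | minus with all? P?
...   | yes all = inj₂ (all , ≡.refl)
...   | no ¬all with k , ¬Pk ← ¬∀⟶∃¬ _ _ P? ¬all =
  inj₁ (prefix τ , λ {i} Pi i→j → ≡.trans (prefix-Next τ τ≡+ i→j)
    (≡.cong (_⊗ prefix τ i) (updateAt-minimal i k σ λ { ≡.refl → ¬Pk Pi })))
  where
  τ = updateAt σ k opposite
  τ≡+ : product τ ≡ plus
  τ≡+ = ≡.trans (product-updateAt σ k) (≡.cong opposite eq)

-- Successors and predecessors on the cycle.

Next-functional : ∀ {m} {i j k : Fin m} → Next i j → Next i k → j ≡ k
Next-functional (inj₁ p) (inj₁ q) = toℕ-injective (≡.trans p (≡.sym q))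
Next-functional {j = j} (inj₁ p) (inj₂ (q , _)) = contradiction (≡.trans p q) (ℕ.<⇒≢ (Fin.toℕ<n j))
Next-functional {k = k} (inj₂ (q , _)) (inj₁ p) = contradiction (≡.trans p q) (ℕ.<⇒≢ (Fin.toℕ<n k))
Next-functional (inj₂ (_ , p)) (inj₂ (_ , q)) = toℕ-injective (≡.trans p (≡.sym q))

Next-injective : ∀ {m} {i j k : Fin m} → Next i k → Next j k → i ≡ j
Next-injective (inj₁ p) (inj₁ q) = toℕ-injective (ℕ.suc-injective (≡.trans (≡.sym p) q))
Next-injective (inj₁ p) (inj₂ (_ , q)) = contradiction (≡.trans (≡.sym q) p) λ ()
Next-injective (inj₂ (_ , q)) (inj₁ p) = contradiction (≡.trans (≡.sym q) p) λ ()
Next-injective (inj₂ (p , _)) (inj₂ (q , _)) = toℕ-injective (ℕ.suc-injective (≡.trans p (≡.sym q)))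

-- Stepping forth and back through the closing edge would force length 1 or 2. Hence the two cycle
-- neighbours of a vertex are distinct.
Next-asym : ∀ {m} → 3 ℕ.≤ m → {i j : Fin m} → Next i j → ¬ Next j i
Next-asym _ (inj₁ p) (inj₁ q) = ℕ.m+1+n≢n 1 (≡.trans (≡.sym (≡.cong suc p)) (≡.sym q))
Next-asym (s≤s (s≤s (s≤s _))) (inj₁ p) (inj₂ (q , r)) =
  contradiction (≡.trans (≡.sym q) (≡.cong suc (≡.trans p (≡.cong suc r)))) λ ()
Next-asym (s≤s (s≤s (s≤s _))) (inj₂ (q , r)) (inj₁ p) =
  contradiction (≡.trans (≡.sym q) (≡.cong suc (≡.trans p (≡.cong suc r)))) λ ()
Next-asym (s≤s (s≤s (s≤s _))) (inj₂ (q , _)) (inj₂ (_ , r)) =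
  contradiction (≡.trans (≡.sym q) (≡.cong suc r)) λ ()

-- Edge signs of a perfect matching.

module Matching {n} (G : SimpleGraph (Fin n)) (M : PerfectMatching G) where
  open PerfectMatching M

  partner : Fin n → Fin n
  partner u = proj₁ (covers u)

  partner-adj : ∀ u → Adj G u (partner u)
  partner-adj u = isEdge (proj₂ (covers u))

  partner-sym : ∀ {u v} → partner u ≡ v → partner v ≡ u
  partner-sym {u} ≡.refl = unique (proj₂ (covers _)) (symmetric (proj₂ (covers u)))

  edgeSign : Fin n → Fin n → Sign
  edgeSign u v with partner u Fin.≟ v
  ... | yes _ = minus
  ... | no  _ = plus

  edgeSign-partner : ∀ {u v} → partner u ≡ v → edgeSign u v ≡ minus
  edgeSign-partner {u} {v} p with partner u Fin.≟ v
  ... | yes _ = ≡.refl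
  ... | no ¬p = contradiction p ¬p

  edgeSign-nonpartner : ∀ {u v} → partner u ≢ v → edgeSign u v ≡ plus
  edgeSign-nonpartner {u} {v} ¬p with partner u Fin.≟ v
  ... | yes p = contradiction p ¬p
  ... | no  _ = ≡.refl

  edgeSign-sym : ∀ u v → edgeSign u v ≡ edgeSign v u
  edgeSign-sym u v with partner u Fin.≟ v
  ... | yes p = ≡.sym (edgeSign-partner (partner-sym p))
  ... | no ¬p = ≡.sym (edgeSign-nonpartner (¬p ∘ partner-sym))

  -- Balance of a signed graph in Harary's sense: `Y` is a switching function that makes all edges
  -- positive.
  Balanced : Set
  Balanced = Σ (Fin n → Sign) λ Y → (∀ u v → Adj G u v → Y v ≡ edgeSign u v ⊗ Y u)

-- Balance of a subgraph of the sun graph.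

module Embedded {n} (G : SimpleGraph (Fin n)) (M : PerfectMatching G)
  {m} (3≤m : 3 ℕ.≤ m) (f : Fin n → Fin m ⊎ Fin m) (f-inj : Injective _≡_ _≡_ f)
  (f-hom : ∀ {u v} → Adj G u v → SunAdj m 3≤m (f u) (f v)) where

  open Matching G M

  hom : ∀ {u v a b} → f u ≡ a → f v ≡ b → Adj G u v → SunAdj m 3≤m a b
  hom ≡.refl ≡.refl = f-hom

  injective : ∀ {u v a} → f u ≡ a → f v ≡ a → u ≡ v
  injective p q = f-inj (≡.trans p (≡.sym q))

  pendant-neighbour : ∀ {u v i} → f u ≡ inj₂ i → Adj G u v → f v ≡ inj₁ i
  pendant-neighbour {v = v} fu u~v with f v in fv | hom fu ≡.refl u~v
  ... | inj₁ j | i≡j = ≡.cong inj₁ (≡.sym i≡j)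

  -- A pendant vertex has only one possible neighbour, so the matching must use the pendant edge.
  pendant-partner : ∀ {u v i} → f u ≡ inj₂ i → Adj G u v → partner u ≡ v
  pendant-partner fu u~v = injective (pendant-neighbour fu (partner-adj _)) (pendant-neighbour fu u~v)

  -- An edge of `G` lying over the edge of the sun's cycle that leaves `i`, oriented in the
  -- direction of `Next`.
  record CycleEdge (i : Fin m) (u v : Fin n) : Set where
    constructor cycleEdge
    field
      {target} : Fin m
      start    : f u ≡ inj₁ i
      end      : f v ≡ inj₁ target
      step     : Next i target
      adjacent : Adj G u v

  cycleEdge? : ∀ i u v → Dec (CycleEdge i u v)
  cycleEdge? i u v = map′ (λ { (p , (_ , q , r) , s) → cycleEdge p q r s })
                          (λ { (cycleEdge p q r s) → p , (_ , q , r) , s })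
    ((f u ≟ inj₁ i) ×-dec any? (λ j → (f v ≟ inj₁ j) ×-dec next? i j) ×-dec adj? G u v)
    where _≟_ = ≡-dec Fin._≟_ Fin._≟_

  CycleEdgePresent : Fin m → Set
  CycleEdgePresent i = ∃[ u ] ∃[ v ] CycleEdge i u v

  cycleEdgePresent? : Decidable CycleEdgePresent
  cycleEdgePresent? i = any? λ u → any? λ v → cycleEdge? i u v

  -- Makes the sign read off a cycle edge independent of which witness the decision procedure
  -- returns.
  cycleEdge-unique : ∀ {i u v u′ v′} → CycleEdge i u v → CycleEdge i u′ v′ → u ≡ u′ × v ≡ v′
  cycleEdge-unique (cycleEdge p q r _) (cycleEdge p′ q′ r′ _) =
    injective p p′ , injective q (≡.trans q′ (≡.cong inj₁ (Next-functional r′ r)))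

  cycleSign : Vector Sign m
  cycleSign i with cycleEdgePresent? i
  ... | yes (u , v , _) = edgeSign u v
  -- An arbitrary default: over a missing edge the sign constrains nothing.
  ... | no _            = plus

  cycleSign-edge : ∀ {i u v} → CycleEdge i u v → cycleSign i ≡ edgeSign u v
  cycleSign-edge {i} e with cycleEdgePresent? i
  ... | no ¬e = contradiction (_ , _ , e) ¬e
  ... | yes (_ , _ , e′) with ≡.refl , ≡.refl ← cycleEdge-unique e e′ = ≡.refl

  module _ (y : Fin m → Sign) (y-step : ∀ {i j} → CycleEdgePresent i → Next i j → y j ≡ cycleSign i ⊗ y i) where

    -- Every pendant edge is a matching edge and so has sign `minus`, which forces the opposite
    -- value at the pendant vertex.
    extend : Fin m ⊎ Fin m → Sign
    extend (inj₁ i) = y i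
    extend (inj₂ i) = opposite (y i)

    extend-forward : ∀ {u v i j} → f u ≡ inj₁ i → f v ≡ inj₁ j → Next i j → Adj G u v → y j ≡ edgeSign u v ⊗ y i
    extend-forward {i = i} fu fv i→j u~v = ≡.trans (y-step (_ , _ , e) i→j) (≡.cong (_⊗ y i) (cycleSign-edge e))
      where e = cycleEdge fu fv i→j u~v

    extend-balanced : ∀ u v → Adj G u v → extend (f v) ≡ edgeSign u v ⊗ extend (f u)
    extend-balanced u v u~v with f u in fu | f v in fv | hom ≡.refl ≡.refl u~v
    ... | inj₁ i | inj₁ j | inj₁ i→j = extend-forward fu fv i→j u~v
    -- An edge traversed backwards: the forward relation is multiplied by the edge sign, which is
    -- its own inverse.
    ... | inj₁ i | inj₁ j | inj₂ j→i = begin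
      y j                                        ≡⟨ ≡.cong (_⊗ y j) (Sign.s*s≡+ (edgeSign u v)) ⟨
      (edgeSign u v ⊗ edgeSign u v) ⊗ y j        ≡⟨ Sign.*-assoc (edgeSign u v) (edgeSign u v) (y j) ⟩
      edgeSign u v ⊗ (edgeSign u v ⊗ y j)        ≡⟨ ≡.cong (λ s → edgeSign u v ⊗ (s ⊗ y j)) (edgeSign-sym u v) ⟩
      edgeSign u v ⊗ (edgeSign v u ⊗ y j)        ≡⟨ ≡.cong (edgeSign u v ⊗_) (extend-forward fv fu j→i (symm G u~v)) ⟨
      edgeSign u v ⊗ y i                         ∎
      where open ≡-Reasoning
    ... | inj₁ i | inj₂ j | ≡.refl =
      ≡.cong (_⊗ y i) (≡.sym (≡.trans (edgeSign-sym u v) (edgeSign-partner (pendant-partner fv (symm G u~v)))))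
    ... | inj₂ i | inj₁ j | ≡.refl =
      ≡.sym (≡.trans (≡.cong (_⊗ opposite (y i)) (edgeSign-partner (pendant-partner fu u~v))) (Sign.opposite-involutive _))

  balanced-or-negative : Balanced ⊎ ((∀ i → CycleEdgePresent i) × product cycleSign ≡ minus)
  balanced-or-negative with potential cycleSign cycleEdgePresent?
  ... | inj₁ (y , y-step) = inj₁ (extend y y-step ∘ f , extend-balanced y y-step)
  ... | inj₂ negative     = inj₂ negative

-- Finite sums, and signs acting on real numbers.

module Signed {c ℓ₁ ℓ₂ ℓ₃} (ℝ : RealNumbers c ℓ₁ ℓ₂ ℓ₃) where
  open RealNumbers ℝ hiding (zero)
  open Spectral ℝ
  open CommutativeRing commutativeRing using (ring)
  open HeytingProperties heytingCommutativeRing using (1#0)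
  open RingProperties ring
  open Sum semiring using (sum-remove; sum-replicate-zero; sum-cong-≋; ∑-distrib-+; *-distribʳ-sum)
  open ≈-Reasoning setoid

  sum-zero : ∀ {n} {t : Vector Carrier n} → (∀ i → t i ≈ 0#) → sum t ≈ 0#
  sum-zero {n} t≈0 = trans (sum-cong-≋ t≈0) (sum-replicate-zero n)

  sum-single : ∀ {n} {t : Vector Carrier n} a → (∀ i → i ≢ a → t i ≈ 0#) → sum t ≈ t a
  sum-single {suc n} {t} a t≈0 = begin
    sum t                        ≈⟨ sum-remove t ⟩
    t a + sum (removeAt t a)     ≈⟨ +-congˡ (sum-zero λ i → t≈0 (punchIn a i) (punchInᵢ≢i a i)) ⟩
    t a + 0#                     ≈⟨ +-identityʳ (t a) ⟩
    t a                          ∎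

  sum-pair : ∀ {n} {t : Vector Carrier n} {a b} → a ≢ b → (∀ i → i ≢ a → i ≢ b → t i ≈ 0#) → sum t ≈ t a + t b
  sum-pair {suc n} {t} {a} {b} a≢b t≈0 = begin
    sum t                        ≈⟨ sum-remove t ⟩
    t a + sum (removeAt t a)     ≈⟨ +-congˡ (sum-single b′ rest≈0) ⟩
    t a + t (punchIn a b′)       ≡⟨ ≡.cong (λ i → t a + t i) (punchIn-punchOut a≢b) ⟩
    t a + t b                    ∎
    where
    b′ = punchOut a≢b
    rest≈0 : ∀ i → i ≢ b′ → t (punchIn a i) ≈ 0#
    rest≈0 i i≢b′ = t≈0 (punchIn a i) (punchInᵢ≢i a i)
      λ eq → i≢b′ (Fin.punchIn-injective a i b′ (≡.trans eq (≡.sym (punchIn-punchOut a≢b))))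

  -- Converts the degree, a list length, into a row sum of the adjacency matrix. The function `g` is
  -- arbitrary so that the induction can pass to `g ∘ suc`.
  length-filter : ∀ {ℓ} {A : Set} {P : Pred A ℓ} (P? : Decidable P) {n} (g : Fin n → A) →
                  length (filter P? (tabulate g)) · 1# ≈ sum (λ i → if does (P? (g i)) then 1# else 0#)
  length-filter P? {ℕ.zero} g = refl
  length-filter P? {suc n} g with does (P? (g zero))
  ... | true  = +-congˡ (length-filter P? (g ∘ suc))
  ... | false = trans (length-filter P? (g ∘ suc)) (sym (+-identityˡ _))

  -- Adding `x` to `x < 0` gives `0 < x`, and likewise in the other direction, so `x` is not apart
  -- from zero; tightness of the apartness gives equality.
  x+x≈0⇒x≈0 : ∀ {x} → x + x ≈ 0# → x ≈ 0#
  x+x≈0⇒x≈0 {x} x+x≈0 = proj₁ (tight _ _) λ x#0 → [ x≮0 , x≯0 ]′ (#⇒<⊎> x#0)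
    where
    open IsStrictPartialOrder isStrictPartialOrder using (<-respˡ-≈; <-respʳ-≈)
      renaming (irrefl to <-irrefl; trans to <-trans)
    x≮0 : ¬ x < 0#
    x≮0 x<0 = <-irrefl refl (<-trans x<0 (<-respˡ-≈ x+x≈0 (<-respʳ-≈ (+-identityˡ x) (+-monoˡ-< x x<0))))
    x≯0 : ¬ 0# < x
    x≯0 0<x = <-irrefl refl (<-trans 0<x (<-respʳ-≈ x+x≈0 (<-respˡ-≈ (+-identityˡ x) (+-monoˡ-< x 0<x))))

  ⟦_⟧ : Sign → Carrier
  ⟦ plus ⟧  = 1#
  ⟦ minus ⟧ = - 1#

  ⟦⟧-opposite : ∀ s → ⟦ opposite s ⟧ ≈ - ⟦ s ⟧
  ⟦⟧-opposite plus  = refl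
  ⟦⟧-opposite minus = sym (-‿involutive 1#)

  ⟦⟧-homo : ∀ s t → ⟦ s ⊗ t ⟧ ≈ ⟦ s ⟧ * ⟦ t ⟧
  ⟦⟧-homo plus  t = sym (*-identityˡ ⟦ t ⟧)
  ⟦⟧-homo minus t = trans (⟦⟧-opposite t) (sym (-1*x≈-x ⟦ t ⟧))

  ⟦⟧-square : ∀ s x → ⟦ s ⟧ * (⟦ s ⟧ * x) ≈ x
  ⟦⟧-square s x = begin
    ⟦ s ⟧ * (⟦ s ⟧ * x)     ≈⟨ *-assoc _ _ x ⟨
    (⟦ s ⟧ * ⟦ s ⟧) * x     ≈⟨ *-congʳ (⟦⟧-homo s s) ⟨
    ⟦ s ⊗ s ⟧ * x           ≡⟨ ≡.cong (λ r → ⟦ r ⟧ * x) (Sign.s*s≡+ s) ⟩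
    1# * x                  ≈⟨ *-identityˡ x ⟩
    x                       ∎

  ⟦⟧≉0 : ∀ s → ¬ ⟦ s ⟧ ≈ 0#
  ⟦⟧≉0 s s≈0 = #-irrefl 1≈0 1#0
    where
    1≈0 : 1# ≈ 0#
    1≈0 = begin
      1#                      ≈⟨ ⟦⟧-square s 1# ⟨
      ⟦ s ⟧ * (⟦ s ⟧ * 1#)    ≈⟨ *-congʳ s≈0 ⟩
      0# * (⟦ s ⟧ * 1#)       ≈⟨ zeroˡ _ ⟩
      0#                      ∎

  -- Each `w i` is `prefix σ i` times `w zero`, and one full turn gives `w zero` equal to its own
  -- negative. Applied twice below: to the flow along the cycle, then to the eigenvector itself.
  negative-cycle : ∀ {m} (σ : Vector Sign m) → product σ ≡ minus → (w : Fin m → Carrier) →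
                   (∀ {i j} → Next i j → w j ≈ ⟦ σ i ⟧ * w i) → ∀ i → w i ≈ 0#
  negative-cycle {suc m} σ σ≡- w w-step i = trans (w-prefix i) (trans (*-congˡ w₀≈0) (zeroʳ _))
    where
    step : ∀ {i j} → w i ≈ ⟦ prefix σ i ⟧ * w zero → Next i j → w j ≈ ⟦ σ i ⊗ prefix σ i ⟧ * w zero
    step {i} {j} wᵢ i→j = begin
      w j                                     ≈⟨ w-step i→j ⟩
      ⟦ σ i ⟧ * w i                           ≈⟨ *-congˡ wᵢ ⟩
      ⟦ σ i ⟧ * (⟦ prefix σ i ⟧ * w zero)     ≈⟨ *-assoc _ _ _ ⟨
      ⟦ σ i ⟧ * ⟦ prefix σ i ⟧ * w zero       ≈⟨ *-congʳ (⟦⟧-homo (σ i) (prefix σ i)) ⟨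
      ⟦ σ i ⊗ prefix σ i ⟧ * w zero           ∎

    w-prefix : ∀ i → w i ≈ ⟦ prefix σ i ⟧ * w zero
    w-prefix = <-weakInduction _ (sym (*-identityˡ _)) λ i wᵢ →
      let i+1≡ = ≡.cong suc (≡.sym (toℕ-inject₁ i)) in
      trans (step wᵢ (inj₁ i+1≡)) (reflexive (≡.cong (λ s → ⟦ s ⟧ * w zero) (≡.sym (prefix-suc σ i+1≡))))

    last : suc (toℕ (fromℕ m)) ≡ suc m
    last = ≡.cong suc (toℕ-fromℕ m)

    w₀≈-w₀ : w zero ≈ - w zero
    w₀≈-w₀ = begin
      -- The closing edge, from the last vertex back to vertex zero.
      w zero                                              ≈⟨ step (w-prefix (fromℕ m)) (inj₂ (last , ≡.refl)) ⟩
      ⟦ σ (fromℕ m) ⊗ prefix σ (fromℕ m) ⟧ * w zero       ≡⟨ ≡.cong (λ s → ⟦ s ⟧ * w zero) (prefix-last σ last) ⟨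
      ⟦ product σ ⟧ * w zero                              ≡⟨ ≡.cong (λ s → ⟦ s ⟧ * w zero) σ≡- ⟩
      - 1# * w zero                                       ≈⟨ -1*x≈-x (w zero) ⟩
      - w zero                                            ∎

    w₀≈0 : w zero ≈ 0#
    w₀≈0 = x+x≈0⇒x≈0 (trans (+-congˡ w₀≈-w₀) (-‿inverseʳ _))

  -- Flows and the Laplacian.

  module Flow {n} (G : SimpleGraph (Fin n)) (M : PerfectMatching G) where
    open Matching G M

    -- The sum runs over all vertices, weighted by adjacency entries, so that it combines term by
    -- term with rows of the Laplacian.
    neighbourSum : Fin n → Vector Carrier n → Carrier
    neighbourSum v t = sum λ u → adjacencyMatrix G v u * t u

    adjacency-term : ∀ {v u x} → Adj G v u → adjacencyMatrix G v u * x ≈ x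
    adjacency-term {v} {u} {x} v~u with adj? G v u
    ... | yes _   = *-identityˡ x
    ... | no v≁u  = contradiction v~u v≁u

    nonadjacency-term : ∀ v u {x} → (Adj G v u → x ≈ 0#) → adjacencyMatrix G v u * x ≈ 0#
    nonadjacency-term v u {x} x≈0 with adj? G v u
    ... | yes v~u = trans (*-identityˡ x) (x≈0 v~u)
    ... | no _    = zeroˡ x

    neighbourSum-zero : ∀ {v t} → (∀ u → Adj G v u → t u ≈ 0#) → neighbourSum v t ≈ 0#
    neighbourSum-zero t≈0 = sum-zero λ u → nonadjacency-term _ u (t≈0 u)

    neighbourSum-single : ∀ {v t} a → Adj G v a → (∀ u → Adj G v u → u ≢ a → t u ≈ 0#) → neighbourSum v t ≈ t a
    neighbourSum-single a v~a t≈0 =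
      trans (sum-single a λ u u≢a → nonadjacency-term _ u λ v~u → t≈0 u v~u u≢a) (adjacency-term v~a)

    neighbourSum-pair : ∀ {v t a b} → a ≢ b → Adj G v a → Adj G v b →
                        (∀ u → Adj G v u → u ≢ a → u ≢ b → t u ≈ 0#) → neighbourSum v t ≈ t a + t b
    neighbourSum-pair a≢b v~a v~b t≈0 = trans
      (sum-pair a≢b λ u u≢a u≢b → nonadjacency-term _ u λ v~u → t≈0 u v~u u≢a u≢b)
      (+-cong (adjacency-term v~a) (adjacency-term v~b))

    degreeMatrix-row : ∀ X v → (degreeMatrix G *ᵥ X) v ≈ neighbourSum v λ _ → X v
    degreeMatrix-row X v = begin
      (degreeMatrix G *ᵥ X) v               ≈⟨ sum-single v off-diagonal ⟩
      degreeMatrix G v v * X v              ≈⟨ *-congʳ diagonal ⟩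
      sum (adjacencyMatrix G v) * X v       ≈⟨ *-distribʳ-sum (X v) (adjacencyMatrix G v) ⟩
      neighbourSum v (λ _ → X v)            ∎
      where
      off-diagonal : ∀ u → u ≢ v → degreeMatrix G v u * X u ≈ 0#
      off-diagonal u u≢v with v Fin.≟ u
      ... | yes v≡u = contradiction (≡.sym v≡u) u≢v
      ... | no _    = zeroˡ (X u)

      diagonal : degreeMatrix G v v ≈ sum (adjacencyMatrix G v)
      diagonal with v Fin.≟ v
      ... | yes _   = length-filter (adj? G v) (λ u → u)
      ... | no v≢v = contradiction ≡.refl v≢v

    -- The first vertex is the one at which flows are summed. The value is the defect in the
    -- relation that `X u` is the edge sign times `X v`.
    flow : Vector Carrier n → Fin n → Fin n → Carrier
    flow X v u = X u - ⟦ edgeSign v u ⟧ * X v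

    -- The signed degree Σ_{u ~ v} s_vu is deg v − 2, because only the partner has sign −1.
    laplacian-flow : ∀ X v → (laplacian G *ᵥ X) v + neighbourSum v (flow X v) ≈ 2# * X v
    -- With the signed sum `rest` added, both sides become the degree of `v` times `X v`.
    laplacian-flow X v = +-cancelʳ rest _ _ (begin
      (laplacian G *ᵥ X) v + neighbourSum v (flow X v) + rest    ≈⟨ +-congʳ (∑-distrib-+ Lx Af) ⟨
      sum (λ u → Lx u + Af u) + rest                             ≈⟨ ∑-distrib-+ (λ u → Lx u + Af u) As ⟨
      sum (λ u → Lx u + Af u + As u)                             ≈⟨ sum-cong-≋ cancel ⟩
      (degreeMatrix G *ᵥ X) v                                    ≈⟨ degreeMatrix-row X v ⟩
      neighbourSum v (λ _ → X v)                                 ≈⟨ sum-cong-≋ split ⟩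
      sum (λ u → A u * double u + As u)                          ≈⟨ ∑-distrib-+ (λ u → A u * double u) As ⟩
      neighbourSum v double + rest                               ≈⟨ +-congʳ twice ⟩
      2# * X v + rest                                            ∎)
      where
      A = adjacencyMatrix G v
      D = degreeMatrix G v
      signed double Lx Af As : Vector Carrier n
      signed u = ⟦ edgeSign v u ⟧ * X v
      double u = X v - signed u
      Lx u = laplacian G v u * X u
      Af u = A u * flow X v u
      As u = A u * signed u
      rest = neighbourSum v signed

      cancel : ∀ u → laplacian G v u * X u + A u * flow X v u + A u * signed u ≈ D u * X u
      cancel u = begin
        (D u - A u) * X u + A u * flow X v u + A u * signed u      ≈⟨ +-assoc _ _ _ ⟩
        (D u - A u) * X u + (A u * flow X v u + A u * signed u)    ≈⟨ +-congˡ (distribˡ (A u) _ _) ⟨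
        (D u - A u) * X u + A u * (flow X v u + signed u)          ≈⟨ +-congˡ (*-congˡ (//-rightDividesˡ (signed u) (X u))) ⟩
        (D u - A u) * X u + A u * X u                              ≈⟨ distribʳ (X u) _ _ ⟨
        (D u - A u + A u) * X u                                    ≈⟨ *-congʳ (//-rightDividesˡ (A u) (D u)) ⟩
        D u * X u                                                  ∎

      split : ∀ u → A u * X v ≈ A u * double u + A u * signed u
      split u = trans (*-congˡ (sym (//-rightDividesˡ (signed u) (X v)))) (distribˡ (A u) _ _)

      twice : neighbourSum v double ≈ 2# * X v
      twice = begin
        neighbourSum v double        ≈⟨ neighbourSum-single (partner v) (partner-adj v) double≈0 ⟩
        double (partner v)           ≡⟨ ≡.cong (λ s → X v - ⟦ s ⟧ * X v) (edgeSign-partner ≡.refl) ⟩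
        X v - (- 1# * X v)           ≈⟨ +-congˡ (-‿cong (-1*x≈-x (X v))) ⟩
        X v - - X v                  ≈⟨ +-congˡ (-‿involutive (X v)) ⟩
        X v + X v                    ≈⟨ +-cong (*-identityˡ _) (*-identityˡ _) ⟨
        1# * X v + 1# * X v          ≈⟨ distribʳ (X v) 1# 1# ⟨
        (1# + 1#) * X v              ≈⟨ *-congʳ (+-congˡ (+-identityʳ 1#)) ⟨
        2# * X v                     ∎
        where
        double≈0 : ∀ u → Adj G v u → u ≢ partner v → double u ≈ 0#
        double≈0 u _ u≢p = begin
          X v - signed u       ≡⟨ ≡.cong (λ s → X v - ⟦ s ⟧ * X v) (edgeSign-nonpartner (u≢p ∘ ≡.sym)) ⟩
          X v - 1# * X v       ≈⟨ +-congˡ (-‿cong (*-identityˡ (X v))) ⟩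
          X v - X v            ≈⟨ -‿inverseʳ (X v) ⟩
          0#                   ∎

    -- The edge sign s is symmetric with square one, so x_v - s x_u = -s (x_u - s x_v).
    flow-reverse : ∀ X u v → flow X u v ≈ - (⟦ edgeSign u v ⟧ * flow X v u)
    flow-reverse X u v = sym (begin
      - (s * (X u - ⟦ edgeSign v u ⟧ * X v))     ≡⟨ ≡.cong (λ r → - (s * (X u - ⟦ r ⟧ * X v))) (edgeSign-sym v u) ⟩
      - (s * (X u - s * X v))                    ≈⟨ -‿cong (x[y-z]≈xy-xz s (X u) (s * X v)) ⟩
      - (s * X u - s * (s * X v))                ≈⟨ ⁻¹-anti-homo‿- (s * X u) (s * (s * X v)) ⟩
      s * (s * X v) - s * X u                    ≈⟨ +-congʳ (⟦⟧-square (edgeSign u v) (X v)) ⟩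
      X v - s * X u                              ∎)
      where s = ⟦ edgeSign u v ⟧

    flow-reverse-zero : ∀ X u v → flow X v u ≈ 0# → flow X u v ≈ 0#
    flow-reverse-zero X u v flow≈0 =
      trans (flow-reverse X u v) (trans (-‿cong (trans (*-congˡ flow≈0) (zeroʳ _))) -0#≈0#)

    eigenvector-flow : ∀ {X} → (∀ v → (laplacian G *ᵥ X) v ≈ 2# * X v) → ∀ v → neighbourSum v (flow X v) ≈ 0#
    eigenvector-flow {X} LX≈2X v = +-identityʳ-unique _ _ (trans (laplacian-flow X v) (sym (LX≈2X v)))

    flow-eigenvector : ∀ {X} → (∀ v u → Adj G v u → flow X v u ≈ 0#) → ∀ v → (laplacian G *ᵥ X) v ≈ 2# * X v
    flow-eigenvector {X} flow≈0 v = begin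
      (laplacian G *ᵥ X) v                                  ≈⟨ +-identityʳ _ ⟨
      (laplacian G *ᵥ X) v + 0#                             ≈⟨ +-congˡ (neighbourSum-zero (flow≈0 v)) ⟨
      (laplacian G *ᵥ X) v + neighbourSum v (flow X v)      ≈⟨ laplacian-flow X v ⟩
      2# * X v                                              ∎

    balanced-eigenvector : ((Y , _) : Balanced) → ∀ v → (laplacian G *ᵥ (⟦_⟧ ∘ Y)) v ≈ 2# * ⟦ Y v ⟧
    balanced-eigenvector (Y , balanced) = flow-eigenvector λ v u v~u → begin
      ⟦ Y u ⟧ - ⟦ edgeSign v u ⟧ * ⟦ Y v ⟧         ≈⟨ +-congˡ (-‿cong (⟦⟧-homo (edgeSign v u) (Y v))) ⟨
      ⟦ Y u ⟧ - ⟦ edgeSign v u ⊗ Y v ⟧             ≡⟨ ≡.cong (λ s → ⟦ Y u ⟧ - ⟦ s ⟧) (balanced v u v~u) ⟨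
      ⟦ Y u ⟧ - ⟦ Y u ⟧                            ≈⟨ -‿inverseʳ _ ⟩
      0#                                           ∎

  -- Vanishing of solutions of L X = 2 X on a negative cycle.

  module Sun {n} (G : SimpleGraph (Fin n)) (M : PerfectMatching G)
    {m} (3≤m : 3 ℕ.≤ m) (f : Fin n → Fin m ⊎ Fin m) (f-inj : Injective _≡_ _≡_ f)
    (f-hom : ∀ {u v} → Adj G u v → SunAdj m 3≤m (f u) (f v))
    {X : Vector Carrier n} (LX≈2X : ∀ v → (laplacian G *ᵥ X) v ≈ 2# * X v) where
    open Matching G M
    open Embedded G M 3≤m f f-inj f-hom
    open Flow G M

    -- The net flow at a pendant vertex consists of this single flow.
    pendant-flow : ∀ {u v i} → f u ≡ inj₂ i → Adj G u v → flow X u v ≈ 0#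
    pendant-flow {u} {v} fu u~v = trans (sym (neighbourSum-single v u~v only)) (eigenvector-flow LX≈2X u)
      where
      only : ∀ w → Adj G u w → w ≢ v → flow X u w ≈ 0#
      only w u~w w≢v = contradiction (injective (pendant-neighbour fu u~w) (pendant-neighbour fu u~v)) w≢v

    -- A pendant edge at `v` carries no flow, so the flows at `v` along its two cycle edges cancel;
    -- reversing the one towards `u` produces the edge sign.
    flow-transfer : ∀ {i j u v w} → CycleEdge i u v → CycleEdge j v w → flow X v w ≈ ⟦ edgeSign u v ⟧ * flow X u v
    flow-transfer {i} {j} {u} {v} {w} (cycleEdge fu fv i→ u~v) (cycleEdge fv′ fw j→ v~w)
      with ≡.refl ← inj₁-injective (≡.trans (≡.sym fv) fv′) = begin
      flow X v w                             ≈⟨ +-inverseˡ-unique _ _ balance ⟩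
      - flow X v u                           ≈⟨ -‿cong (flow-reverse X v u) ⟩
      - - (⟦ edgeSign v u ⟧ * flow X u v)    ≈⟨ -‿involutive _ ⟩
      ⟦ edgeSign v u ⟧ * flow X u v          ≡⟨ ≡.cong (λ s → ⟦ s ⟧ * flow X u v) (edgeSign-sym v u) ⟩
      ⟦ edgeSign u v ⟧ * flow X u v          ∎
      where
      w≢u : w ≢ u
      w≢u ≡.refl with ≡.refl ← inj₁-injective (≡.trans (≡.sym fw) fu) = Next-asym 3≤m i→ j→

      elsewhere : ∀ x → Adj G v x → x ≢ w → x ≢ u → flow X v x ≈ 0#
      elsewhere x v~x x≢w x≢u with f x in fx | hom fv ≡.refl v~x
      ... | inj₁ k | inj₁ j→k = contradiction (injective fx (≡.trans fw (≡.cong inj₁ (Next-functional j→ j→k)))) x≢w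
      ... | inj₁ k | inj₂ k→j = contradiction (injective fx (≡.trans fu (≡.cong inj₁ (Next-injective i→ k→j)))) x≢u
      ... | inj₂ k | _        = flow-reverse-zero X v x (pendant-flow fx (symm G v~x))

      balance : flow X v w + flow X v u ≈ 0#
      balance = trans (sym (neighbourSum-pair w≢u v~w (symm G u~v) elsewhere)) (eigenvector-flow LX≈2X v)

    module _ (edge : ∀ i → CycleEdgePresent i) (σ≡- : product cycleSign ≡ minus) where
      private
        tail-of head-of : Fin m → Fin n
        tail-of i = proj₁ (edge i)
        head-of i = proj₁ (proj₂ (edge i))

      -- The edges over consecutive positions are chosen separately; injectivity of `f` makes them
      -- meet in one vertex of `G`.
      head-of≡tail-of : ∀ {i j} → Next i j → head-of i ≡ tail-of j
      head-of≡tail-of {i} {j} i→j with edge i | edge j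
      ... | _ , _ , cycleEdge _ fv i→ _ | _ , _ , cycleEdge fv′ _ _ _ =
        injective fv (≡.trans fv′ (≡.cong inj₁ (Next-functional i→j i→)))

      cycle-flow : ∀ i → flow X (tail-of i) (head-of i) ≈ 0#
      cycle-flow = negative-cycle cycleSign σ≡- (λ i → flow X (tail-of i) (head-of i)) step
        where
        step : ∀ {i j} → Next i j → flow X (tail-of j) (head-of j) ≈ ⟦ cycleSign i ⟧ * flow X (tail-of i) (head-of i)
        step {i} {j} i→j with edge i | edge j | head-of≡tail-of i→j
        ... | u , v , e | v , w , e′ | ≡.refl =
          trans (flow-transfer e e′) (reflexive (≡.cong (λ s → ⟦ s ⟧ * flow X u v) (≡.sym (cycleSign-edge e))))

      -- Once the flow along the cycle vanishes, `X` obeys the same sign recurrence, and the same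
      -- argument applies to it.
      cycle-zero : ∀ i → X (tail-of i) ≈ 0#
      cycle-zero = negative-cycle cycleSign σ≡- (X ∘ tail-of) step
        where
        step : ∀ {i j} → Next i j → X (tail-of j) ≈ ⟦ cycleSign i ⟧ * X (tail-of i)
        step {i} {j} i→j = begin
          X v                          ≡⟨ ≡.cong X (head-of≡tail-of i→j) ⟨
          X (head-of i)                ≈⟨ x∙y⁻¹≈ε⇒x≈y _ _ (cycle-flow i) ⟩
          ⟦ edgeSign u _ ⟧ * X u       ≡⟨ ≡.cong (λ s → ⟦ s ⟧ * X u) (cycleSign-edge (proj₂ (proj₂ (edge i)))) ⟨
          ⟦ cycleSign i ⟧ * X u        ∎
          where
          u = tail-of i
          v = tail-of j

      cycle-vertex-zero : ∀ {v i} → f v ≡ inj₁ i → X v ≈ 0#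
      cycle-vertex-zero {v} {i} fv =
        trans (reflexive (≡.cong X (injective fv (CycleEdge.start (proj₂ (proj₂ (edge i))))))) (cycle-zero i)

      all-zero : ∀ v → X v ≈ 0#
      all-zero v with f v in fv
      ... | inj₁ i = cycle-vertex-zero fv
      -- The pendant edge has zero flow, so `X v` is a sign times the value at its partner on the
      -- cycle.
      ... | inj₂ i = begin
        X v                                  ≈⟨ x∙y⁻¹≈ε⇒x≈y _ _ flow≈0 ⟩
        ⟦ edgeSign p v ⟧ * X p               ≈⟨ *-congˡ (cycle-vertex-zero (pendant-neighbour fv (partner-adj v))) ⟩
        ⟦ edgeSign p v ⟧ * 0#                ≈⟨ zeroʳ _ ⟩
        0#                                   ∎
        where
        p = partner v
        flow≈0 : flow X p v ≈ 0#
        flow≈0 = flow-reverse-zero X p v (pendant-flow fv (partner-adj v))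

theorem4 : ∀ {c ℓ₁ ℓ₂ ℓ₃} (ℝ : RealNumbers c ℓ₁ ℓ₂ ℓ₃) →
    let open RealNumbers ℝ
        open Spectral ℝ
    in
    (n : ℕ) (G : SimpleGraph (Fin n)) →
    BrokenSun G → PerfectMatching G → IsEigenvalue (laplacian G) 2# →
    ∃[ r ] (r # 0# × ∃[ X ] (IsEigenvector (laplacian G) 2# X × (∀ i → X i ≈ - r ⊎ X i ≈ r)))
theorem4 ℝ n G (((v , _) , _) , m , 3≤m , f , f-inj , f-hom) M (X , X≉0 , LX≈2X) =
  -- Here r = 1. The vertex `v` supplied by connectedness witnesses that the sign vector is not
  -- zero.
  1# , 1#0 , (⟦_⟧ ∘ Y) , ((λ Y≈0 → ⟦⟧≉0 (Y v) (Y≈0 v)) , balanced-eigenvector balanced) , ±1 ∘ Y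
  where
  open RealNumbers ℝ using (1#; -_; _≈_; refl; heytingCommutativeRing)
  open HeytingProperties heytingCommutativeRing using (1#0)
  open Signed ℝ
  open Flow G M
  open Matching G M
  open Embedded G M 3≤m f f-inj f-hom using (balanced-or-negative)

  balanced : Balanced
  balanced with balanced-or-negative
  ... | inj₁ b            = b
  -- This is where the assumed eigenvector enters: a negative cycle would force it to vanish.
  ... | inj₂ (edge , σ≡-) = contradiction (Sun.all-zero G M 3≤m f f-inj f-hom LX≈2X edge σ≡-) X≉0

  Y : Fin n → Sign
  Y = proj₁ balanced

  ±1 : ∀ s → ⟦ s ⟧ ≈ - 1# ⊎ ⟦ s ⟧ ≈ 1#
  ±1 minus = inj₁ refl
  ±1 plus  = inj₂ refl
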